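{- Let $K$ be a multiplicative group isomorphic to the additive group of $\mathbb{F}_q$, let $G=\{g_0=1,g_1,\dots,g_{v-1}\}$ be a finite group of order $v$ with $q\mid v$, and let $\psi:G\times G\to K$ be a normalized cocycle. If $\psi$ is orthogonal, then $C=(\Phi(E_\psi),\star)$ is a generalized Hadamard full propelinear code (GHFP-code), where $x\star y=\Phi\big(\Phi^{ -1}(x)\cdot\Phi^{ -1}(y)\big)$ for $x,y\in\Phi(E_\psi)$, and $K^v$ is identified with $\mathbb{F}_q^v$ via a fixed isomorphism $\mathbb{F}_q\cong K$.
   Context: Cocycles. A normalized cocycle is a map $\psi:G\times G\to K$ with $\psi(g,h)\psi(gh,k)=\psi(g,hk)\psi(h,k)$ and $\psi(g,1)=\psi(1,g)=1$ for all $g,h,k\in G$. It is orthogonal if for each $g\ne1$ in $G$ and each $u\in K$, $|\{h\in G:\psi(g,h)=u\}|=v/q$. The extension group $E_\psi$ is the set $\{(u,g):u\in K,g\in G\}$ with product $(u,g)(w,h)=(uw\,\psi(g,h),gh)$. Put $T(\psi)=\{t_j=(1,g_j):0\le j\le v-1\}$. The map $\Phi$. $\Phi:E_\psi\to K^v$ is defined by: for $(k,g)\in E_\psi$, the $j$-th entry of $\Phi(k,g)$ is the unique $l\in K$ with $(k,g)^{ -1}t_j\in T(\psi)(l,1)$. Equivalently $[\Phi(k,g)]_j=(k\,\psi(g,g^{ -1}))^{ -1}\psi(g^{ -1},g_j)$. The map $\Phi$ is injective, and $\Phi^{ -1}$ denotes its inverse on its image. Generalized Hadamard codes. A $v\times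 v$ matrix $H=(h_{ij})$ over the additive group $\mathbb{F}_q$ is a generalized Hadamard matrix $\mathrm{GH}(q,v/q)$ if for all $i<j$ the multiset $\{h_{ik}-h_{jk}:1\le k\le v\}$ contains each element of $\mathbb{F}_q$ exactly $v/q$ times; it is normalized if its first row and column are zero. For a normalized $H$, $F_H$ is the set of rows of $H$ and $C_H=\bigcup_{\alpha\in\mathbb{F}_q}(F_H+\alpha\mathbf 1)$, with $\mathbf 1$ the all-one vector, is called a generalized Hadamard code. Full propelinear codes. For $\pi\in\mathcal{S}_n$ and $y\in\mathbb{F}_q^n$, $\pi(y)=(y_{\pi^{ -1}(1)},\dots,y_{\pi^{ -1}(n)})$. A code $C\subseteq\mathbb{F}_q^n$ with $\mathbf 0\in C$ and operation $\star$ is full propelinear if to every $x\in C$ is assigned $\pi_x\in\mathcal{S}_n$ such that $x\star y=x+\pi_x(y)$ and: (i) $x\star C=C$ for all $x\in C$; (ii) $\pi_{x\star y}=\pi_x\circ\pi_y$ for all $x,y\in C$; (iii) $\pi_x$ fixes no coordinate if $x\notin\{\alpha\mathbf 1:\alpha\in\mathbb{F}_q\}$, and $\pi_x=\mathrm{Id}$ if $x=\alpha\mathbf 1$ for some $\alpha\in\mathbb{F}_q$. A GHFP-code is a generalized Hadamard code that is full propelinear. -}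

module Defs where

open import Algebra.Bundles using (Group; AbelianGroup; CommutativeRing)
open import Algebra.Core using (Op₂)
open import Algebra.Definitions using (Congruent₂)
open import Algebra.Morphism.Structures using (IsGroupIsomorphism)
import Algebra.Properties.AbelianGroup as AbelianGroupProperties
import Algebra.Solver.CommutativeMonoid as CommutativeMonoidSolver
open import Data.Fin.Base using (Fin; toℕ; _<_)
open import Data.Fin.Permutation as Perm
  using (Permutation′; _⟨$⟩ʳ_; _⟨$⟩ˡ_)
open import Data.Nat.Base using (ℕ)
open import Data.Nat.Divisibility using (_∣_; quotient)
open import Data.Product.Base using (Σ; ∃; _×_; _,_; proj₁; proj₂)
open import Data.Product.Relation.Binary.Pointwise.NonDependent using (×-setoid)
open import Data.Vec.Functional using (Vector; replicate; zipWith)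
import Data.Vec.Functional.Relation.Binary.Equality.Setoid as VecEq
open import Function.Base using (_on_)
open import Function.Bundles using (Inverse; _⇔_; mk⇔)
open import Level using (Level; _⊔_; suc)
open import Relation.Binary.Bundles using (Setoid)
open import Relation.Binary.Core using (Rel)
import Relation.Binary.Construct.On as On
open import Relation.Binary.PropositionalEquality.Core using (_≡_; _≢_)
open import Relation.Binary.PropositionalEquality.Properties using (setoid)
import Relation.Binary.Reasoning.Setoid as SetoidReasoning
open import Relation.Nullary.Negation.Core using (¬_)
open import Relation.Unary using (Pred; _∈_; _≐_)

private
  variable
    a ℓ p k ℓk : Level

infix 4 _HasSize_

_HasSize_ : Setoid a ℓ → ℕ → Set (a ⊔ ℓ)
S HasSize n = Inverse (setoid (Fin n)) S

-- Elements of the subset are compared in S; membership proofs are ignored.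
Subset : (S : Setoid a ℓ) → Pred (Setoid.Carrier S) p → Setoid (a ⊔ p) ℓ
Subset S P = On.setoid S (proj₁ {B = P})

record FiniteField (q : ℕ) (c ℓ : Level) : Set (suc (c ⊔ ℓ)) where
  field
    commutativeRing : CommutativeRing c ℓ
  open CommutativeRing commutativeRing public
  field
    0≉1     : ¬ 0# ≈ 1#
    inverse : ∀ x → ¬ x ≈ 0# → ∃ λ y → x * y ≈ 1#
    order   : CommutativeRing.setoid commutativeRing HasSize q

------------------------------------------------------------------------
-- Codes over a finite field

module Codes {q : ℕ} {c ℓ : Level} (F : FiniteField q c ℓ) where

  private module F = FiniteField F
  open VecEq F.setoid using (_≋_)

  infixl 6 _⊹_
  _⊹_ : ∀ {n} → Op₂ (Vector F.Carrier n)
  _⊹_ = zipWith F._+_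

  Matrix : ℕ → Set c
  Matrix v = Vector (Vector F.Carrier v) v

  -- GH(q , v/q)
  IsGeneralizedHadamard : ∀ {v} → q ∣ v → Matrix v → Set (c ⊔ ℓ)
  IsGeneralizedHadamard {v} q∣v H =
    ∀ (i j : Fin v) → i < j → ∀ u →
    Subset (setoid (Fin v)) (λ m → H i m F.- H j m F.≈ u) HasSize quotient q∣v

  IsNormalized : ∀ {v} → Matrix v → Set ℓ
  IsNormalized {v} H =
    (∀ (i j : Fin v) → toℕ i ≡ 0 → H i j F.≈ F.0#) ×
    (∀ (i j : Fin v) → toℕ j ≡ 0 → H i j F.≈ F.0#)

  -- C_H, the union of the translates F_H + α𝟏
  HadamardCode : ∀ {v} → Matrix v → Pred (Vector F.Carrier v) (c ⊔ ℓ)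
  HadamardCode H x = ∃ λ α → ∃ λ i → x ≋ H i ⊹ replicate _ α

  IsGeneralizedHadamardCode : ∀ {v} → q ∣ v →
    Pred (Vector F.Carrier v) p → Set (c ⊔ ℓ ⊔ p)
  IsGeneralizedHadamardCode {v = v} q∣v C = ∃ λ (H : Matrix v) →
    IsGeneralizedHadamard q∣v H × IsNormalized H × C ≐ HadamardCode H

  -- π(y) = (y_{π⁻¹(1)} , … , y_{π⁻¹(n)})
  permute : ∀ {n} → Permutation′ n → Vector F.Carrier n → Vector F.Carrier n
  permute π y i = y (π ⟨$⟩ˡ i)

  IsConstant : ∀ {n} → Pred (Vector F.Carrier n) (c ⊔ ℓ)
  IsConstant x = ∃ λ α → x ≋ replicate _ α

  -- A codeword is a vector together with a proof of membership.  The fields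
  -- ⋆-cong and π-cong say that ⋆ and x ↦ π_x depend on the vectors alone.
  record IsFullPropelinear {n : ℕ} {p : Level}
           (C : Pred (Vector F.Carrier n) p) (_⋆_ : Op₂ (Σ _ C))
           : Set (c ⊔ ℓ ⊔ p) where

    _≈ᶜ_ : Rel (Σ _ C) ℓ
    _≈ᶜ_ = _≋_ on proj₁

    field
      0∈C     : replicate n F.0# ∈ C
      ⋆-cong  : Congruent₂ _≈ᶜ_ _⋆_
      π       : Σ _ C → Permutation′ n
      π-cong  : ∀ x y → x ≈ᶜ y → π x Perm.≈ π y
      ⋆-def   : ∀ x y → proj₁ (x ⋆ y) ≋ proj₁ x ⊹ permute (π x) (proj₁ y)
      x⋆C≐C   : ∀ x → (λ z → ∃ λ y → z ≋ proj₁ (x ⋆ y)) ≐ C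
      π-homo  : ∀ x y i → π (x ⋆ y) ⟨$⟩ʳ i ≡ π x ⟨$⟩ʳ (π y ⟨$⟩ʳ i)
      π-free  : ∀ x → ¬ IsConstant (proj₁ x) → ∀ i → π x ⟨$⟩ʳ i ≢ i
      π-const : ∀ x → IsConstant (proj₁ x) → π x Perm.≈ Perm.id

  IsGHFPCode : ∀ {v} → q ∣ v →
    (C : Pred (Vector F.Carrier v) p) → Op₂ (Σ _ C) → Set (c ⊔ ℓ ⊔ p)
  IsGHFPCode q∣v C _⋆_ =
    IsGeneralizedHadamardCode q∣v C × IsFullPropelinear C _⋆_

------------------------------------------------------------------------
-- Cocycles

-- K is written multiplicatively; being isomorphic to the additive group of
-- a field, it is abelian.
record NormalizedCocycle (G : Group a ℓ) (K : AbelianGroup k ℓk)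
         : Set (a ⊔ ℓ ⊔ k ⊔ ℓk) where
  private
    module G = Group G
    module K = AbelianGroup K
  field
    ψ           : G.Carrier → G.Carrier → K.Carrier
    ψ-cong      : ∀ {g g′ h h′} → g G.≈ g′ → h G.≈ h′ → ψ g h K.≈ ψ g′ h′
    cocycle     : ∀ g h m →
                  ψ g h K.∙ ψ (g G.∙ h) m K.≈ ψ g (h G.∙ m) K.∙ ψ h m
    normalizedʳ : ∀ g → ψ g G.ε K.≈ K.ε
    normalizedˡ : ∀ g → ψ G.ε g K.≈ K.ε

-- The parameter is meant to be v/q.
IsOrthogonal : {G : Group a ℓ} {K : AbelianGroup k ℓk} →
  NormalizedCocycle G K → ℕ → Set (a ⊔ ℓ ⊔ k ⊔ ℓk)
IsOrthogonal {G = G} {K = K} Ψ v/q =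
  ∀ g → ¬ g G.≈ G.ε → ∀ u →
  Subset G.setoid (λ h → ψ g h K.≈ u) HasSize v/q
  where
  module G = Group G
  module K = AbelianGroup K
  open NormalizedCocycle Ψ

module Extension {a ℓ k ℓk : Level} {G : Group a ℓ} {K : AbelianGroup k ℓk}
                 (Ψ : NormalizedCocycle G K) where

  private
    module G = Group G
    module K = AbelianGroup K
  open NormalizedCocycle Ψ
  open AbelianGroupProperties K using (⁻¹-∙-comm)
  open CommutativeMonoidSolver K.commutativeMonoid
    using (solve; _⊕_; _⊜_)
  open SetoidReasoning K.setoid

  ψ-inverse : ∀ g → ψ g (g G.⁻¹) K.≈ ψ (g G.⁻¹) g
  ψ-inverse g = begin
    ψ g (g G.⁻¹)                               ≈⟨ K.identityʳ _ ⟨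
    ψ g (g G.⁻¹) K.∙ K.ε                       ≈⟨ K.∙-congˡ (normalizedˡ g) ⟨
    ψ g (g G.⁻¹) K.∙ ψ G.ε g                   ≈⟨ K.∙-congˡ (ψ-cong (G.inverseʳ g) G.refl) ⟨
    ψ g (g G.⁻¹) K.∙ ψ (g G.∙ g G.⁻¹) g        ≈⟨ cocycle g (g G.⁻¹) g ⟩
    ψ g (g G.⁻¹ G.∙ g) K.∙ ψ (g G.⁻¹) g        ≈⟨ K.∙-congʳ (ψ-cong G.refl (G.inverseˡ g)) ⟩
    ψ g G.ε K.∙ ψ (g G.⁻¹) g                   ≈⟨ K.∙-congʳ (normalizedʳ g) ⟩
    K.ε K.∙ ψ (g G.⁻¹) g                       ≈⟨ K.identityˡ _ ⟩
    ψ (g G.⁻¹) g                               ∎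

  _∙ᴱ_ : Op₂ (K.Carrier × G.Carrier)
  (u , g) ∙ᴱ (w , h) = u K.∙ w K.∙ ψ g h , g G.∙ h

  private
    assocᴷ : ∀ u g w h x m →
      u K.∙ w K.∙ ψ g h K.∙ x K.∙ ψ (g G.∙ h) m K.≈
      u K.∙ (w K.∙ x K.∙ ψ h m) K.∙ ψ g (h G.∙ m)
    assocᴷ u g w h x m = begin
      u K.∙ w K.∙ ψ g h K.∙ x K.∙ ψ (g G.∙ h) m
        ≈⟨ solve 5 (λ u w x r s →
             (((u ⊕ w) ⊕ r) ⊕ x) ⊕ s ⊜ ((u ⊕ w) ⊕ x) ⊕ (r ⊕ s))
             K.refl u w x (ψ g h) (ψ (g G.∙ h) m) ⟩
      u K.∙ w K.∙ x K.∙ (ψ g h K.∙ ψ (g G.∙ h) m)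
        ≈⟨ K.∙-congˡ (cocycle g h m) ⟩
      u K.∙ w K.∙ x K.∙ (ψ g (h G.∙ m) K.∙ ψ h m)
        ≈⟨ solve 5 (λ u w x r s →
             ((u ⊕ w) ⊕ x) ⊕ (r ⊕ s) ⊜ (u ⊕ ((w ⊕ x) ⊕ s)) ⊕ r)
             K.refl u w x (ψ g (h G.∙ m)) (ψ h m) ⟩
      u K.∙ (w K.∙ x K.∙ ψ h m) K.∙ ψ g (h G.∙ m) ∎

    identityᴷˡ : ∀ u g → K.ε K.∙ u K.∙ ψ G.ε g K.≈ u
    identityᴷˡ u g = K.trans (K.∙-cong (K.identityˡ u) (normalizedˡ g))
                             (K.identityʳ u)

    identityᴷʳ : ∀ u g → u K.∙ K.ε K.∙ ψ g G.ε K.≈ u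
    identityᴷʳ u g = K.trans (K.∙-cong (K.identityʳ u) (normalizedʳ g))
                             (K.identityʳ u)

    inverseᴷʳ : ∀ u g →
      u K.∙ (u K.∙ ψ g (g G.⁻¹)) K.⁻¹ K.∙ ψ g (g G.⁻¹) K.≈ K.ε
    inverseᴷʳ u g = K.trans
      (solve 3 (λ u y r → (u ⊕ y) ⊕ r ⊜ (u ⊕ r) ⊕ y) K.refl u _ _)
      (K.inverseʳ _)

    inverseᴷˡ : ∀ u g →
      (u K.∙ ψ g (g G.⁻¹)) K.⁻¹ K.∙ u K.∙ ψ (g G.⁻¹) g K.≈ K.ε
    inverseᴷˡ u g = begin
      (u K.∙ ψ g (g G.⁻¹)) K.⁻¹ K.∙ u K.∙ ψ (g G.⁻¹) g
        ≈⟨ K.∙-congˡ (ψ-inverse g) ⟨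
      (u K.∙ ψ g (g G.⁻¹)) K.⁻¹ K.∙ u K.∙ ψ g (g G.⁻¹)
        ≈⟨ K.assoc _ _ _ ⟩
      (u K.∙ ψ g (g G.⁻¹)) K.⁻¹ K.∙ (u K.∙ ψ g (g G.⁻¹))
        ≈⟨ K.inverseˡ _ ⟩
      K.ε ∎

  E : Group (a ⊔ k) (ℓ ⊔ ℓk)
  E = record
    { Carrier = K.Carrier × G.Carrier
    ; _≈_     = Setoid._≈_ (×-setoid K.setoid G.setoid)
    ; _∙_     = _∙ᴱ_
    ; ε       = K.ε , G.ε
    ; _⁻¹     = λ (u , g) → (u K.∙ ψ g (g G.⁻¹)) K.⁻¹ , g G.⁻¹
    ; isGroup = record
      { isMonoid = record
        { isSemigroup = record
          { isMagma = record
            { isEquivalence = Setoid.isEquivalence (×-setoid K.setoid G.setoid)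
            ; ∙-cong = λ (u≈ , g≈) (w≈ , h≈) →
                K.∙-cong (K.∙-cong u≈ w≈) (ψ-cong g≈ h≈) , G.∙-cong g≈ h≈
            }
          ; assoc = λ (u , g) (w , h) (x , m) →
              assocᴷ u g w h x m , G.assoc g h m
          }
        ; identity = (λ (u , g) → identityᴷˡ u g , G.identityˡ g)
                   , (λ (u , g) → identityᴷʳ u g , G.identityʳ g)
        }
      ; inverse = (λ (u , g) → inverseᴷˡ u g , G.inverseˡ g)
                , (λ (u , g) → inverseᴷʳ u g , G.inverseʳ g)
      ; ⁻¹-cong = λ (u≈ , g≈) →
          K.⁻¹-cong (K.∙-cong u≈ (ψ-cong g≈ (G.⁻¹-cong g≈))) , G.⁻¹-cong g≈
      }
    }

  module E = Group E

  -- enum lists the elements of G as g₀ , … , g_{v-1}.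
  module Transversal {v : ℕ} (enum : G.setoid HasSize v) where

    open Inverse enum using (to; from; strictlyInverseˡ)

    t : Fin v → E.Carrier
    t j = K.ε , to j

    Φ : E.Carrier → Vector K.Carrier v
    Φ (u , g) j = (u K.∙ ψ g (g G.⁻¹)) K.⁻¹ K.∙ ψ (g G.⁻¹) (to j)

    private
      t∙l : ∀ i l → t i E.∙ (l , G.ε) E.≈ (l , to i)
      t∙l i l = K.trans (K.∙-cong (K.identityˡ l) (normalizedʳ (to i)))
                        (K.identityʳ l)
              , G.identityʳ (to i)

      e⁻¹∙t : ∀ e j → e E.⁻¹ E.∙ t j E.≈ (Φ e j , proj₂ e G.⁻¹ G.∙ to j)
      e⁻¹∙t e j = K.∙-congʳ (K.identityʳ _) , G.refl

    -- The j-th entry of Φ e is the unique l with e⁻¹ t_j ∈ T(ψ)(l , 1).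
    Φ-unique : ∀ e j l →
      (∃ λ i → e E.⁻¹ E.∙ t j E.≈ t i E.∙ (l , G.ε)) ⇔ (Φ e j K.≈ l)
    Φ-unique e j l = mk⇔
      (λ (i , eq) →
        proj₁ (E.trans (E.sym (e⁻¹∙t e j)) (E.trans eq (t∙l i l))))
      (λ eq → from (proj₂ e G.⁻¹ G.∙ to j) ,
        E.trans (e⁻¹∙t e j)
          (E.trans (eq , G.sym (strictlyInverseˡ _)) (E.sym (t∙l _ l))))

    -- The image of Φ, transported from Kᵛ to 𝔽_qᵛ along a fixed isomorphism φ.
    module Image
      {q : ℕ} {c ℓc : Level} (F : FiniteField q c ℓc)
      {φ : FiniteField.Carrier F → K.Carrier}
      (φ-iso : IsGroupIsomorphism (Group.rawGroup (FiniteField.+-group F)) K.rawGroup φ)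
      where

      private module F = FiniteField F
      open IsGroupIsomorphism φ-iso using (surjective)

      φ⁻¹ : K.Carrier → F.Carrier
      φ⁻¹ y = proj₁ (surjective y)

      code : Pred (Vector F.Carrier v) (a ⊔ k ⊔ ℓk)
      code x = ∃ λ e → ∀ j → φ (x j) K.≈ Φ e j

      Φ̂ : E.Carrier → Σ _ code
      Φ̂ e = (λ j → φ⁻¹ (Φ e j)) , e , λ j → proj₂ (surjective (Φ e j)) F.refl

      -- The preimage recorded in the membership proof.  It depends on the
      -- codeword alone (up to equality in E) exactly when Φ is injective.
      Φ̂⁻¹ : Σ _ code → E.Carrier
      Φ̂⁻¹ (x , e , φx≈Φe) = e

      _⋆_ : Op₂ (Σ _ code)
      x ⋆ y = Φ̂ (Φ̂⁻¹ x E.∙ Φ̂⁻¹ y)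

{-# OPTIONS --safe #-}

-- Since Φ e j = w ψ(h , g_j) for e⁻¹ = (w , h), the codewords are exactly the
-- translates of the rows of (ψ(g_i , g_j)).  The cocycle identity turns the
-- quotient of rows g and h into a row of ψ at g h⁻¹, so orthogonality makes
-- the matrix generalized Hadamard, and also Φ injective: distinct rows attain
-- every quotient, not only 1.  Finally (e e′)⁻¹ t_j = e′⁻¹ (e⁻¹ t_j) gives
-- Φ(e e′)_j = Φ(e)_j Φ(e′)_{π⁻¹ j}, where π is left translation by the
-- G-component of e; it has a fixed point only when that component is 1.
module Submission where

open import Algebra.Bundles using (Group; AbelianGroup)
open import Algebra.Morphism.Structures using (IsGroupIsomorphism)
import Algebra.Properties.Group as GroupProperties
open import Data.Empty using (⊥-elim)
open import Data.Fin.Base using (Fin; toℕ; zero)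
open import Data.Fin.Permutation using (Permutation′)
open import Data.Fin.Properties using (<⇒≢; _≟_)
open import Data.Nat.Base using (ℕ; zero; suc)
open import Data.Nat.Divisibility using (_∣_; quotient; divides)
open import Data.Product.Base using (_,_; proj₁; proj₂)
open import Function.Base using (_∘_)
open import Function.Bundles using (Inverse; Equivalence; mk↔ₛ′)
import Function.Construct.Composition as Composition
import Function.Construct.Symmetry as Symmetry
open import Level using (Level)
open import Relation.Binary.Bundles using (Setoid)
open import Relation.Binary.PropositionalEquality.Core using (_≡_; refl; sym; trans)
import Relation.Binary.Reasoning.Setoid as SetoidReasoning
open import Relation.Nullary.Decidable.Core using (yes; no)
open import Relation.Nullary.Negation.Core using (¬_)
open import Relation.Unary using (Pred)
open import Defs

private
  variable
    a ℓ b ℓ′ p p′ k ℓk c ℓc : Level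

-- Counting tools: bijections between subsets, and left translations.

Subset-inverse : {S : Setoid a ℓ} {T : Setoid b ℓ′} (I : Inverse S T)
  {P : Pred (Setoid.Carrier S) p} {Q : Pred (Setoid.Carrier T) p′} →
  (∀ x → P x → Q (Inverse.to I x)) → (∀ y → Q y → P (Inverse.from I y)) →
  Inverse (Subset S P) (Subset T Q)
Subset-inverse I P⇒Q Q⇒P = record
  { to        = λ (x , px) → I.to x , P⇒Q x px
  ; from      = λ (y , qy) → I.from y , Q⇒P y qy
  ; to-cong   = I.to-cong
  ; from-cong = I.from-cong
  ; inverse   = I.inverseˡ , I.inverseʳ
  }
  where module I = Inverse I

-- An index below `v` excludes `v = 0 * q`. A bijection from `Fin (v/q)` thus yields an actual
-- element.
quotient-inhabited : ∀ {q v} (q∣v : q ∣ v) → Fin v → Fin (quotient q∣v)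
quotient-inhabited (divides zero    refl) ()
quotient-inhabited (divides (suc _) _)    _ = zero

module _ (G : Group a ℓ) where
  open Group G
  open GroupProperties G

  leftTranslation : Carrier → Inverse setoid setoid
  leftTranslation g = record
    { to        = g ∙_
    ; from      = g ⁻¹ ∙_
    ; to-cong   = ∙-congˡ
    ; from-cong = ∙-congˡ
    ; inverse   = (λ {x} eq → Group.trans G (∙-congˡ eq) (\\-leftDividesˡ g x))
                , (λ {x} eq → Group.trans G (∙-congˡ eq) (\\-leftDividesʳ g x))
    }

-- Quotients of two rows of a cocycle.

module CocycleProperties {G : Group a ℓ} {K : AbelianGroup k ℓk}
                         (Ψ : NormalizedCocycle G K) where
  private
    module G = Group G
    module K = AbelianGroup K
  open NormalizedCocycle Ψ
  open GroupProperties G using (//-rightDividesˡ; \\-leftDividesˡ; x∙y⁻¹≈ε⇒x≈y)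
  open GroupProperties K.group using ()
    renaming (∙-cancelʳ to K-cancelʳ; //-rightDividesˡ to K-//-rightDividesˡ)
  open SetoidReasoning K.setoid

  infixl 7 _/ψ_at_
  _/ψ_at_ : G.Carrier → G.Carrier → G.Carrier → K.Carrier
  g /ψ h at m = ψ g m K.∙ ψ h m K.⁻¹

  -- This is the cocycle identity at `(g h⁻¹ , h , m)`, using `g h⁻¹ h = g`, after division by
  -- `ψ h m`. Since `ψ (g h⁻¹) h` does not depend on `m`, the quotient of the rows is, up to a
  -- constant, the single row at `g h⁻¹` read at `h m`.
  rowQuotient : ∀ g h m →
    g /ψ h at m K.∙ ψ (g G.∙ h G.⁻¹) h K.≈ ψ (g G.∙ h G.⁻¹) (h G.∙ m)
  rowQuotient g h m = K-cancelʳ (ψ h m) _ _ (begin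
    ψ g m K.∙ ψ h m K.⁻¹ K.∙ ψ d h K.∙ ψ h m
      ≈⟨ K.assoc _ _ _ ⟩
    ψ g m K.∙ ψ h m K.⁻¹ K.∙ (ψ d h K.∙ ψ h m)
      ≈⟨ K.∙-congˡ (K.comm _ _) ⟩
    ψ g m K.∙ ψ h m K.⁻¹ K.∙ (ψ h m K.∙ ψ d h)
      ≈⟨ K.assoc _ _ _ ⟨
    ψ g m K.∙ ψ h m K.⁻¹ K.∙ ψ h m K.∙ ψ d h
      ≈⟨ K.∙-congʳ (K-//-rightDividesˡ (ψ h m) (ψ g m)) ⟩
    ψ g m K.∙ ψ d h
      ≈⟨ K.comm _ _ ⟩
    ψ d h K.∙ ψ g m
      ≈⟨ K.∙-congˡ (ψ-cong (//-rightDividesˡ h g) G.refl) ⟨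
    ψ d h K.∙ ψ (d G.∙ h) m
      ≈⟨ cocycle d h m ⟩
    ψ d (h G.∙ m) K.∙ ψ h m ∎)
    where d = g G.∙ h G.⁻¹

  -- With `d = g h⁻¹`, which differs from 1, the bijection `m ↦ h m` matches these columns with the
  -- solutions `x` of `ψ d x = u ψ d h`, and orthogonality counts the latter.
  rowQuotient-size : ∀ {n} → IsOrthogonal Ψ n → ∀ {g h} → ¬ g G.≈ h → ∀ u →
    Subset G.setoid (λ m → g /ψ h at m K.≈ u) HasSize n
  rowQuotient-size orthogonal {g} {h} g≉h u = Composition.inverse
    (orthogonal d (g≉h ∘ x∙y⁻¹≈ε⇒x≈y g h) (u K.∙ ψ d h))
    (Subset-inverse (Symmetry.inverse (leftTranslation G h))
      (λ x ψdx≈u∙ψdh → K-cancelʳ (ψ d h) _ _ (begin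
        g /ψ h at (h G.⁻¹ G.∙ x) K.∙ ψ d h  ≈⟨ rowQuotient g h _ ⟩
        ψ d (h G.∙ (h G.⁻¹ G.∙ x))          ≈⟨ ψ-cong G.refl (\\-leftDividesˡ h x) ⟩
        ψ d x                               ≈⟨ ψdx≈u∙ψdh ⟩
        u K.∙ ψ d h                         ∎))
      (λ m eq → K.trans (K.sym (rowQuotient g h m)) (K.∙-congʳ eq)))
    where d = g G.∙ h G.⁻¹

module Proposition {q v : ℕ}
  (F : FiniteField q c ℓc) (K : AbelianGroup k ℓk)
  {φ : FiniteField.Carrier F → AbelianGroup.Carrier K}
  (φ-iso : IsGroupIsomorphism (Group.rawGroup (FiniteField.+-group F))
                              (AbelianGroup.rawGroup K) φ)
  (G : Group a ℓ) (enum : Group.setoid G HasSize v)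
  (g₀≈1 : ∀ (j : Fin v) → toℕ j ≡ 0 →
          Group._≈_ G (Inverse.to enum j) (Group.ε G))
  (q∣v : q ∣ v) (Ψ : NormalizedCocycle G K)
  (orthogonal : IsOrthogonal Ψ (quotient q∣v))
  where

  private
    module F = FiniteField F
    module G = Group G
    module K = AbelianGroup K
    module GP = GroupProperties G
    module KP = GroupProperties K.group
  open NormalizedCocycle Ψ
  open CocycleProperties Ψ
  open Extension Ψ using (E; module E)
  open Extension.Transversal Ψ enum
  open Image F φ-iso
  open Codes F
  open Inverse enum using (to; from; from-cong; strictlyInverseˡ; strictlyInverseʳ)
  open IsGroupIsomorphism φ-iso
    using (injective; surjective; ∙-homo; ε-homo; ⁻¹-homo; ⟦⟧-cong)
  private
    module EP = GroupProperties E

  -- Transfer between `F` and `K`.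

  φ-φ⁻¹ : ∀ y → φ (φ⁻¹ y) K.≈ y
  φ-φ⁻¹ y = proj₂ (surjective y) F.refl

  φ-+φ⁻¹ : ∀ y z → φ (φ⁻¹ y F.+ φ⁻¹ z) K.≈ y K.∙ z
  φ-+φ⁻¹ y z = K.trans (∙-homo _ _) (K.∙-cong (φ-φ⁻¹ y) (φ-φ⁻¹ z))

  φ-−φ⁻¹ : ∀ y z → φ (φ⁻¹ y F.- φ⁻¹ z) K.≈ y K.∙ z K.⁻¹
  φ-−φ⁻¹ y z = K.trans (∙-homo _ _)
    (K.∙-cong (φ-φ⁻¹ y) (K.trans (⁻¹-homo _) (K.⁻¹-cong (φ-φ⁻¹ z))))

  φ1≉ε : ¬ φ F.1# K.≈ K.ε
  φ1≉ε φ1≈ε = F.0≉1 (injective (K.trans ε-homo (K.sym φ1≈ε)))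

  -- Injectivity of `Φ`.

  from-injective : ∀ {g h} → from g ≡ from h → g G.≈ h
  from-injective {g} {h} eq = G.trans (G.sym (strictlyInverseˡ g))
    (G.trans (Inverse.to-cong enum eq) (strictlyInverseˡ h))

  to-injective : ∀ {i j} → to i G.≈ to j → i ≡ j
  to-injective {i} {j} eq =
    trans (sym (strictlyInverseʳ i)) (trans (from-cong eq) (strictlyInverseʳ j))

  -- If `g` and `h` differed, the quotient of their rows would take the value `φ 1` in some column;
  -- but equal rows have quotient 1 everywhere, and `φ 1` is not the identity.
  equalRows : ∀ {g h} → (∀ m → ψ g m K.≈ ψ h m) → g G.≈ h
  -- Equality in `G` is decided on indices.
  equalRows {g} {h} ψg≈ψh with from g ≟ from h
  ... | yes eq = from-injective eq
  ... | no neq = ⊥-elim (φ1≉ε (K.trans (K.sym eq)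
                   (K.trans (K.∙-congʳ (ψg≈ψh m)) (K.inverseʳ _))))
    where
    quotientOne = Inverse.to
      (rowQuotient-size orthogonal (neq ∘ from-cong) (φ F.1#))
      -- Any index would do; that of the identity always exists.
      (quotient-inhabited q∣v (from G.ε))
    m  = proj₁ quotientOne
    eq = proj₂ quotientOne

  -- With `e⁻¹ = (w , h)`, the vector `Φ e` is `w` times row `h`. Its entry at the identity of `G`
  -- is `w` by normalization; cancelling `w` leaves two equal rows.
  Φ-injective : ∀ e e′ → (∀ j → Φ e j K.≈ Φ e′ j) → e E.≈ e′
  Φ-injective e e′ Φe≈Φe′ = EP.⁻¹-injective (w≈w′ , equalRows (λ m →
      KP.∙-cancelˡ w _ _ (K.trans (rows m) (K.∙-congʳ (K.sym w≈w′)))))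
    where
    w  = proj₁ (e E.⁻¹)
    w′ = proj₁ (e′ E.⁻¹)
    h  = proj₂ (e E.⁻¹)
    h′ = proj₂ (e′ E.⁻¹)
    rows : ∀ m → w K.∙ ψ h m K.≈ w′ K.∙ ψ h′ m
    rows m = K.trans (K.∙-congˡ (ψ-cong G.refl (G.sym (strictlyInverseˡ m))))
      (K.trans (Φe≈Φe′ (from m)) (K.∙-congˡ (ψ-cong G.refl (strictlyInverseˡ m))))
    w≈w′ : w K.≈ w′
    w≈w′ = K.trans (K.sym (K.trans (K.∙-congˡ (normalizedʳ h)) (K.identityʳ w)))
      (K.trans (rows G.ε) (K.trans (K.∙-congˡ (normalizedʳ h′)) (K.identityʳ w′)))

  Φ-cong : ∀ {e e′} → e E.≈ e′ → ∀ j → Φ e j K.≈ Φ e′ j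
  Φ-cong e≈e′ j = K.∙-cong w≈w′ (ψ-cong h≈h′ G.refl)
    where
    w≈w′ = proj₁ (E.⁻¹-cong e≈e′)
    h≈h′ = proj₂ (E.⁻¹-cong e≈e′)

  -- The regular action of `G` on coordinates and its interplay with `Φ`.

  translate : G.Carrier → Fin v → Fin v
  translate g i = from (g G.∙ to i)

  translate-cong : ∀ {g h} → g G.≈ h → ∀ i → translate g i ≡ translate h i
  translate-cong g≈h i = from-cong (G.∙-congʳ g≈h)

  translate-∙ : ∀ g h i → translate (g G.∙ h) i ≡ translate g (translate h i)
  translate-∙ g h i = from-cong (G.trans (G.assoc g h (to i))
    (G.∙-congˡ (G.sym (strictlyInverseˡ _))))

  translate-ε : ∀ {g} → g G.≈ G.ε → ∀ i → translate g i ≡ i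
  translate-ε g≈ε i =
    trans (from-cong (G.trans (G.∙-congʳ g≈ε) (G.identityˡ _))) (strictlyInverseʳ i)

  translate-fixed : ∀ g i → translate g i ≡ i → g G.≈ G.ε
  translate-fixed g i eq = GP.identityˡ-unique g (to i)
    (from-injective (trans eq (sym (strictlyInverseʳ i))))

  translation : G.Carrier → Permutation′ v
  translation g = mk↔ₛ′ (translate g) (translate (g G.⁻¹))
    (λ i → trans (sym (translate-∙ g (g G.⁻¹) i)) (translate-ε (G.inverseʳ g) i))
    (λ i → trans (sym (translate-∙ (g G.⁻¹) g i)) (translate-ε (G.inverseˡ g) i))

  -- By `Φ-unique` it suffices to write `(e e′)⁻¹ t_j` as a transversal element times an element of
  -- `K`. Applying `factor` first to `e` and then to `e′` does so, the two `K`-parts collecting on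
  -- the right in reverse order.
  Φ-∙ : ∀ e e′ j →
    Φ (e E.∙ e′) j K.≈ Φ e j K.∙ Φ e′ (translate (proj₂ e G.⁻¹) j)
  Φ-∙ e e′ j = K.trans (Equivalence.to (Φ-unique (e E.∙ e′) j (l′ K.∙ l)) (i′ , eq))
                       (K.comm l′ l)
    where
    open SetoidReasoning E.setoid
    l  = Φ e j
    i  = translate (proj₂ e G.⁻¹) j
    l′ = Φ e′ i
    i′ = translate (proj₂ e′ G.⁻¹) i
    factor : ∀ e j → e E.⁻¹ E.∙ t j E.≈
             t (translate (proj₂ e G.⁻¹) j) E.∙ (Φ e j , G.ε)
    factor e j = proj₂ (Equivalence.from (Φ-unique e j (Φ e j)) K.refl)
    eq = begin
      (e E.∙ e′) E.⁻¹ E.∙ t j                  ≈⟨ E.∙-congʳ {t j} (EP.⁻¹-anti-homo-∙ e e′) ⟩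
      e′ E.⁻¹ E.∙ e E.⁻¹ E.∙ t j               ≈⟨ E.assoc (e′ E.⁻¹) (e E.⁻¹) (t j) ⟩
      e′ E.⁻¹ E.∙ (e E.⁻¹ E.∙ t j)             ≈⟨ E.∙-congˡ {e′ E.⁻¹} (factor e j) ⟩
      e′ E.⁻¹ E.∙ (t i E.∙ (l , G.ε))          ≈⟨ E.assoc (e′ E.⁻¹) (t i) (l , G.ε) ⟨
      e′ E.⁻¹ E.∙ t i E.∙ (l , G.ε)            ≈⟨ E.∙-congʳ {l , G.ε} (factor e′ i) ⟩
      t i′ E.∙ (l′ , G.ε) E.∙ (l , G.ε)        ≈⟨ E.assoc (t i′) (l′ , G.ε) (l , G.ε) ⟩
      t i′ E.∙ ((l′ , G.ε) E.∙ (l , G.ε))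
        ≈⟨ E.∙-congˡ {t i′} ( K.trans (K.∙-congˡ (normalizedʳ G.ε)) (K.identityʳ _)
                            , G.identityʳ G.ε) ⟩
      t i′ E.∙ (l′ K.∙ l , G.ε)                ∎

  -- Every constant vector is an image under `Φ`. The inverse in the argument offsets the one in
  -- `Φ`, so that the constant is `w` itself.
  Φ-central : ∀ w j → Φ ((w , G.ε) E.⁻¹) j K.≈ w
  Φ-central w j = begin
    Φ ((w , G.ε) E.⁻¹) j   ≈⟨ K.∙-cong (proj₁ (EP.⁻¹-involutive (w , G.ε)))
                                       (ψ-cong (proj₂ (EP.⁻¹-involutive (w , G.ε))) G.refl) ⟩
    w K.∙ ψ G.ε (to j)     ≈⟨ K.∙-congˡ (normalizedˡ _) ⟩
    w K.∙ K.ε              ≈⟨ K.identityʳ w ⟩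
    w                      ∎
    where open SetoidReasoning K.setoid

  -- The constant vector `w` is already the image of `(w , 1)⁻¹`, so injectivity identifies `e` with
  -- that element.
  constant⇒central : ∀ e w → (∀ j → Φ e j K.≈ w) → proj₂ e G.≈ G.ε
  constant⇒central e w Φe≈w = G.trans
    (proj₂ (Φ-injective e ((w , G.ε) E.⁻¹)
      (λ j → K.trans (Φe≈w j) (K.sym (Φ-central w j)))))
    GP.ε⁻¹≈ε

  central⇒constant : ∀ u {g} → g G.≈ G.ε → ∀ j →
    Φ (u , g) j K.≈ proj₁ ((u , g) E.⁻¹)
  central⇒constant u g≈ε j = K.trans
    (K.∙-congˡ (K.trans (ψ-cong (G.trans (G.⁻¹-cong g≈ε) GP.ε⁻¹≈ε) G.refl)
                        (normalizedˡ _)))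
    (K.identityʳ _)

  -- The generalized Hadamard matrix and its code.

  H : Matrix v
  H i j = φ⁻¹ (ψ (to i) (to j))

  H-isGeneralizedHadamard : IsGeneralizedHadamard q∣v H
  -- Under `φ` a difference of rows of `H` becomes a quotient of rows of `ψ`; the enumeration turns
  -- the count over `G` into one over columns.
  H-isGeneralizedHadamard i j i<j u = Composition.inverse
    (rowQuotient-size orthogonal (<⇒≢ i<j ∘ to-injective) (φ u))
    (Subset-inverse (Symmetry.inverse enum)
      (λ g eq → injective (K.trans (φ-−φ⁻¹ _ _)
        (K.trans (K.∙-cong (ψ-cong G.refl (strictlyInverseˡ g))
                           (K.⁻¹-cong (ψ-cong G.refl (strictlyInverseˡ g))))
                 eq)))
      (λ m eq → K.trans (K.sym (φ-−φ⁻¹ _ _)) (⟦⟧-cong eq)))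

  H-isNormalized : IsNormalized H
  H-isNormalized =
      (λ i j i≡0 → φ⁻¹≈0 (K.trans (ψ-cong (g₀≈1 i i≡0) G.refl) (normalizedˡ _)))
    , (λ i j j≡0 → φ⁻¹≈0 (K.trans (ψ-cong G.refl (g₀≈1 j j≡0)) (normalizedʳ _)))
    where
    φ⁻¹≈0 : ∀ {y} → y K.≈ K.ε → φ⁻¹ y F.≈ F.0#
    φ⁻¹≈0 y≈ε = injective (K.trans (φ-φ⁻¹ _) (K.trans y≈ε (K.sym ε-homo)))

  code-isGeneralizedHadamardCode : IsGeneralizedHadamardCode q∣v code
  code-isGeneralizedHadamardCode =
    H , H-isGeneralizedHadamard , H-isNormalized , code⊆ , ⊆code
    where
    code⊆ : ∀ {x} → code x → HadamardCode H x
    -- For `e⁻¹ = (w , h)` the translation constant comes from `w` and the row from `h`.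
    code⊆ (e , φx≈Φe) = φ⁻¹ (proj₁ (e E.⁻¹)) , from (proj₂ (e E.⁻¹)) , λ j →
      injective (K.trans (φx≈Φe j) (K.trans (K.comm _ _)
        (K.trans (K.∙-congʳ (ψ-cong (G.sym (strictlyInverseˡ _)) G.refl))
                 (K.sym (φ-+φ⁻¹ _ _)))))
    ⊆code : ∀ {x} → HadamardCode H x → code x
    -- Conversely, the preimage is the inverse of `(φ α , g_i)`, because `Φ` reads off the
    -- components of the inverse.
    ⊆code (α , i , x≈) = (φ α , to i) E.⁻¹ , λ j →
      K.trans (⟦⟧-cong (x≈ j)) (K.trans (∙-homo _ _) (K.trans (K.comm _ _)
        (K.∙-cong (K.sym (proj₁ e⁻¹⁻¹)) (K.trans (φ-φ⁻¹ _)
          (ψ-cong (G.sym (proj₂ e⁻¹⁻¹)) G.refl)))))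
      where e⁻¹⁻¹ = EP.⁻¹-involutive (φ α , to i)

  -- The full propelinear structure.

  Φ̂⁻¹-cong : ∀ x y → (∀ j → proj₁ x j F.≈ proj₁ y j) → Φ̂⁻¹ x E.≈ Φ̂⁻¹ y
  Φ̂⁻¹-cong (x , e , φx≈Φe) (y , e′ , φy≈Φe′) x≈y = Φ-injective e e′
    (λ j → K.trans (K.sym (φx≈Φe j)) (K.trans (⟦⟧-cong (x≈y j)) (φy≈Φe′ j)))

  φ⁻¹-cong : ∀ {y z} → y K.≈ z → φ⁻¹ y F.≈ φ⁻¹ z
  φ⁻¹-cong y≈z = injective (K.trans (φ-φ⁻¹ _) (K.trans y≈z (K.sym (φ-φ⁻¹ _))))

  code-isFullPropelinear : IsFullPropelinear code _⋆_
  code-isFullPropelinear = record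
    { 0∈C    = E.ε E.⁻¹ , λ j → K.trans ε-homo (K.sym (Φ-central K.ε j))
    -- Injectivity of `Φ` makes the recorded preimage a function of the vector alone, so the product
    -- and `π` are well defined.
    ; ⋆-cong = λ {x} {x′} {y} {y′} x≈x′ y≈y′ j → φ⁻¹-cong
        (Φ-cong (E.∙-cong (Φ̂⁻¹-cong x x′ x≈x′) (Φ̂⁻¹-cong y y′ y≈y′)) j)
    ; π      = λ x → translation (proj₂ (Φ̂⁻¹ x))
    ; π-cong = λ x y x≈y → translate-cong (proj₂ (Φ̂⁻¹-cong x y x≈y))
    ; ⋆-def  = λ (_ , e , φx≈Φe) (_ , e′ , φy≈Φe′) j → injective
        (K.trans (φ-φ⁻¹ _) (K.trans (Φ-∙ e e′ j)
          (K.trans (K.∙-cong (K.sym (φx≈Φe j)) (K.sym (φy≈Φe′ _)))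
                   (K.sym (∙-homo _ _)))))
    ; x⋆C≐C  = λ (_ , e , _) →
          (λ (y , z≈x⋆y) → e E.∙ Φ̂⁻¹ y , λ j →
            K.trans (⟦⟧-cong (z≈x⋆y j)) (φ-φ⁻¹ _))
        -- To reach the image of `e′`, solve for the right factor in the extension group: `e⁻¹ e′`.
        , (λ (e′ , φz≈Φe′) → Φ̂ (e E.⁻¹ E.∙ e′) , λ j → injective
            (K.trans (φz≈Φe′ j) (K.trans
              (Φ-cong (E.sym (EP.\\-leftDividesˡ e e′)) j) (K.sym (φ-φ⁻¹ _)))))
    ; π-homo = λ x y i → translate-∙ (proj₂ (Φ̂⁻¹ x)) (proj₂ (Φ̂⁻¹ y)) i
    -- Contrapositive: a fixed coordinate forces `g = 1`, and row 1 of `ψ` is trivial, so the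
    -- codeword is constant.
    ; π-free = λ (_ , (u , g) , φx≈Φe) x-nonconstant i πi≡i → x-nonconstant
        (φ⁻¹ (proj₁ ((u , g) E.⁻¹)) , λ j → injective (K.trans (φx≈Φe j)
          (K.trans (central⇒constant u (translate-fixed g i πi≡i) j)
                   (K.sym (φ-φ⁻¹ _)))))
    ; π-const = λ (_ , e , φx≈Φe) (α , x≈α) → translate-ε
        (constant⇒central e (φ α)
          (λ j → K.trans (K.sym (φx≈Φe j)) (⟦⟧-cong (x≈α j))))
    }

proposition3p7 : ∀ {a ℓ k ℓk c ℓc : Level} {q v : ℕ}
    (F : FiniteField q c ℓc)
    (K : AbelianGroup k ℓk)
    {φ : FiniteField.Carrier F → AbelianGroup.Carrier K}
    (φ-iso : IsGroupIsomorphism (Group.rawGroup (FiniteField.+-group F)) (AbelianGroup.rawGroup K) φ)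
    (G : Group a ℓ)
    (enum : Group.setoid G HasSize v)
    (g₀≈1 : ∀ (j : Fin v) → toℕ j ≡ 0 → Group._≈_ G (Inverse.to enum j) (Group.ε G))
    (q∣v : q ∣ v)
    (Ψ : NormalizedCocycle G K) →
    IsOrthogonal Ψ (quotient q∣v) →
    let open Extension.Transversal.Image Ψ enum F φ-iso in
    Codes.IsGHFPCode F q∣v code _⋆_
proposition3p7 F K φ-iso G enum g₀≈1 q∣v Ψ orthogonal =
  code-isGeneralizedHadamardCode , code-isFullPropelinear
  where open Proposition F K φ-iso G enum g₀≈1 q∣v Ψ orthogonal
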